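{- Let $G$ be a simple connected graph with $n$ vertices and minimum degree at least three, and let $F$ be a linear forest subgraph of $G$ with at most one edge. Suppose that the length of the longest cycle of $G$ containing $F$ is at least $n-\sqrt{n-1}+1$. Then every longest cycle of $G$ containing $F$ has a chord.
   Context: A linear forest is a graph each of whose components is a path; a linear forest with at most one edge thus consists of isolated vertices together with possibly one edge. A cycle contains $F$ if it passes through all vertices and all edges of $F$; a longest cycle containing $F$ is one of maximum length among all cycles of $G$ containing $F$. A chord of a cycle $C$ in $G$ is an edge of $G$ joining two vertices of $C$ that are not consecutive on $C$. -}

module Defs where

open import Level using (0ℓ)
open import Data.Nat using (ℕ; zero; suc; _≤_; _∸_; _+_; _^_)
open import Data.Nat.DivMod using (_%_; m%n<n)
open import Data.Fin using (Fin; toℕ; fromℕ<)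
open import Data.Product using (Σ; ∃; _×_; _,_)
open import Data.Sum using (_⊎_)
open import Data.Maybe using (Maybe; just; nothing)
open import Data.Unit using (⊤)
open import Relation.Nullary using (¬_)
open import Relation.Binary.PropositionalEquality using (_≡_)
open import Function.Definitions using (Injective)

record SimpleGraph (n : ℕ) : Set₁ where
  field
    Adj     : Fin n → Fin n → Set
    sym     : ∀ {u v} → Adj u v → Adj v u
    irrefl  : ∀ {u} → ¬ Adj u u

data Walk {n : ℕ} (G : SimpleGraph n) : Fin n → Fin n → Set where
  nil  : ∀ {u} → Walk G u u
  cons : ∀ {u v w} → SimpleGraph.Adj G u v → Walk G v w → Walk G u w

Connected : ∀ {n} → SimpleGraph n → Set
Connected G = ∀ u v → Walk G u v

MinDegreeAtLeast3 : ∀ {n} → SimpleGraph n → Set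
MinDegreeAtLeast3 {n} G =
  ∀ v → Σ (Fin 3 → Fin n) λ f → Injective _≡_ _≡_ f × (∀ i → SimpleGraph.Adj G v (f i))

next : ∀ {k} → Fin k → Fin k
next {suc k} i = fromℕ< (m%n<n (suc (toℕ i)) (suc k))

record Cycle {n : ℕ} (G : SimpleGraph n) : Set where
  field
    len    : ℕ
    len≥3  : 3 ≤ len
    vert   : Fin len → Fin n
    inj    : Injective _≡_ _≡_ vert
    adj    : ∀ i → SimpleGraph.Adj G (vert i) (vert (next i))

-- A linear forest subgraph of G with at most one edge:
-- a vertex set together with possibly one edge of G between two of its vertices.
record LinearForest≤1 {n : ℕ} (G : SimpleGraph n) : Set₁ where
  field
    V    : Fin n → Set
    edge : Maybe (Σ (Fin n × Fin n) λ { (u , v) → SimpleGraph.Adj G u v × V u × V v })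

open Cycle

EdgeOfCycle : ∀ {n} {G : SimpleGraph n} → Cycle G → Fin n → Fin n → Set
EdgeOfCycle C u v = ∃ λ i →
  (vert C i ≡ u × vert C (next i) ≡ v) ⊎ (vert C i ≡ v × vert C (next i) ≡ u)

OnCycle : ∀ {n} {G : SimpleGraph n} → Cycle G → Fin n → Set
OnCycle C v = ∃ λ i → vert C i ≡ v

Contains : ∀ {n} {G : SimpleGraph n} → Cycle G → LinearForest≤1 G → Set
Contains C F = (∀ v → LinearForest≤1.V F v → OnCycle C v) × EdgeOK (LinearForest≤1.edge F)
  where
    EdgeOK : Maybe _ → Set
    EdgeOK nothing = ⊤
    EdgeOK (just ((u , v) , _)) = EdgeOfCycle C u v

LongestContaining : ∀ {n} {G : SimpleGraph n} → LinearForest≤1 G → Cycle G → Set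
LongestContaining F C = Contains C F × (∀ (D : Cycle _) → Contains D F → len D ≤ len C)

HasChord : ∀ {n} {G : SimpleGraph n} → Cycle G → Set
HasChord {G = G} C = ∃ λ i → ∃ λ j →
  SimpleGraph.Adj G (vert C i) (vert C j) × ¬ (j ≡ next i) × ¬ (i ≡ next j)

{-# OPTIONS --safe #-}
module Submission where

-- Suppose C has no chord. Each vertex of C has three neighbours of which at most two (its
-- neighbours along C) lie on C, so we can choose for every vertex v of C a neighbour g v off C.
-- Cutting C open at an edge e that carries the edge of F gives a path P through all vertices of C
-- which is longest among the paths with the same ends through all its vertices: closing such a
-- path with e gives a cycle containing F. Now let (a, b) run over the len C - 1 consecutive pairs
-- of P. If g a = g b, inserting g a between a and b lengthens P. If (g a, g b) = (g c, g d) for a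
-- later consecutive pair (c, d), then a, g a, c, ..., b, g b, d (with the segment from b to c
-- reversed) lengthens P by two. So these pairs have distinct images (g a, g b), all among the
-- k ≤ n - len C vertices off C, whence len C - 1 ≤ k², contradicting len C ≥ n - √(n-1) + 1.

open import Defs
open import Level using (Level)
open import Data.Empty using (⊥; ⊥-elim)
open import Data.Fin using (Fin; toℕ; fromℕ<) renaming (zero to fzero; suc to fsuc)
open import Data.Fin.Properties using (toℕ-fromℕ<; toℕ<n; toℕ-injective; any?; all?; ¬∀⟶∃¬)
  renaming (_≟_ to _≟ᶠ_)
open import Data.List
  using ( List; []; _∷_; _++_; _∷ʳ_; _ʳ++_; length; map; head; last; lookup; filter; allFin; applyUpTo
        ; cartesianProduct)
open import Data.List.Properties
  using (length-++; length-map; length-tabulate; length-applyUpTo; applyUpTo-∷ʳ)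
open import Data.List.Membership.Propositional using (_∈_; _∉_)
open import Data.List.Membership.Propositional.Properties
  using ( ∈-lookup; ∈-∃++; ∈-++⁻; ∈-++⁺ˡ; ∈-++⁺ʳ; ∈-map⁻; ∈-filter⁺; ∈-filter⁻; ∈-allFin
        ; ∈-cartesianProduct⁺; ∈-applyUpTo⁺; ∈-applyUpTo⁻)
import Data.List.Membership.DecPropositional as DecMembership
open import Data.List.Relation.Binary.Disjoint.Propositional using (Disjoint)
open import Data.List.Relation.Binary.Subset.Propositional using (_⊆_)
open import Data.List.Relation.Binary.Permutation.Propositional
  using (_↭_; ↭-refl; ↭-sym; ↭-trans; prep; swap; ↭⇒↭ₛ; module PermutationReasoning)
open import Data.List.Relation.Binary.Permutation.Propositional.Properties
  using (shift; shifts; ++⁺ˡ; ++↭ʳ++; ∈-resp-↭; ↭-length)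
import Data.List.Relation.Binary.Permutation.Setoid.Properties as Permutationₛ
open import Data.List.Relation.Unary.All as All using (_∷_)
open import Data.List.Relation.Unary.All.Properties using (¬Any⇒All¬)
open import Data.List.Relation.Unary.AllPairs using ([]; _∷_)
open import Data.List.Relation.Unary.Any as Any using (here; there)
open import Data.List.Relation.Unary.Any.Properties using (lookup-index)
open import Data.List.Relation.Unary.Linked as Linked using (Linked; [-]; _∷_)
import Data.List.Relation.Unary.Linked.Properties as Linkedₚ
open import Data.List.Relation.Unary.Unique.Propositional using (Unique)
import Data.List.Relation.Unary.Unique.Propositional.Properties as Uniqueₚ
open import Data.Maybe using (just; nothing)
open import Data.Maybe.Properties using (just-injective)
open import Data.Nat
  using (ℕ; zero; suc; _≤_; _<_; _∸_; _+_; _*_; _^_; z≤n; s≤s; z<s; pred; NonZero; >-nonZero)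
open import Data.Nat.DivMod
  using (_%_; _mod_; m%n<n; %-distribˡ-+; m%n%n≡m%n; [m+n]%n≡m%n; m<n⇒m%n≡m; n%n≡0)
open import Data.Nat.Properties
open import Data.Product as Product using (∃; ∃₂; _×_; _,_; proj₁; proj₂)
open import Data.Sum as Sum using (_⊎_; inj₁; inj₂)
open import Data.Unit using (tt)
open import Function using (_∘_)
open import Function.Definitions using (Injective)
open import Relation.Binary.Core using (Rel)
open import Relation.Binary.Definitions using (Symmetric)
open import Relation.Binary.PropositionalEquality
  using (_≡_; _≢_; refl; sym; trans; cong; cong₂; subst; subst₂; setoid; module ≡-Reasoning)
open import Relation.Nullary using (¬_; Dec; yes; no; ¬?)
open import Relation.Nullary.Decidable using (_×-dec_; _⊎-dec_; decidable-stable)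

open Cycle

private variable
  a b r : Level
  A : Set a
  B : Set b

last-++-∷ : ∀ (xs : List A) {y ys} → last (xs ++ y ∷ ys) ≡ last (y ∷ ys)
last-++-∷ []           = refl
last-++-∷ (_ ∷ [])     = refl
last-++-∷ (_ ∷ x ∷ xs) = last-++-∷ (x ∷ xs)

last-∷-ʳ++ : ∀ (xs : List A) {z y ys} → last (z ∷ xs ʳ++ y ∷ ys) ≡ last (y ∷ ys)
last-∷-ʳ++ []       = refl
last-∷-ʳ++ (_ ∷ xs) = last-∷-ʳ++ xs

head-++-∷ : ∀ (xs : List A) {y ys zs} → head (xs ++ y ∷ ys) ≡ head (xs ++ y ∷ zs)
head-++-∷ []      = refl
head-++-∷ (_ ∷ _) = refl

head-applyUpTo : ∀ (f : ℕ → A) m .{{_ : NonZero m}} → head (applyUpTo f m) ≡ just (f 0)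
head-applyUpTo f (suc m) = refl

last-applyUpTo : ∀ (f : ℕ → A) m .{{_ : NonZero m}} → last (applyUpTo f m) ≡ just (f (pred m))
last-applyUpTo f (suc m) = trans (cong last (sym (applyUpTo-∷ʳ f m))) (last-++-∷ (applyUpTo f m))

head-lookup : ∀ {xs : List A} (i : Fin (length xs)) → toℕ i ≡ 0 → head xs ≡ just (lookup xs i)
head-lookup {xs = _ ∷ _} fzero _ = refl

last-lookup : ∀ {xs : List A} (i : Fin (length xs)) → suc (toℕ i) ≡ length xs →
              last xs ≡ just (lookup xs i)
last-lookup {xs = _ ∷ []}    fzero    _  = refl
last-lookup {xs = _ ∷ _ ∷ _} (fsuc i) eq = last-lookup i (suc-injective eq)

lookup-injective : ∀ {xs : List A} → Unique xs → ∀ {i j} → lookup xs i ≡ lookup xs j → i ≡ j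
lookup-injective {xs = _ ∷ _} _          {fzero}  {fzero}  _  = refl
lookup-injective {xs = _ ∷ _} (x∉ ∷ _)   {fzero}  {fsuc j} eq = ⊥-elim (All.lookup x∉ (∈-lookup j) eq)
lookup-injective {xs = _ ∷ _} (x∉ ∷ _)   {fsuc i} {fzero}  eq = ⊥-elim (All.lookup x∉ (∈-lookup i) (sym eq))
lookup-injective {xs = _ ∷ _} (_ ∷ uniq) {fsuc i} {fsuc j} eq = cong fsuc (lookup-injective uniq eq)

module _ {R : Rel A r} where

  Linked-lookup : ∀ {xs} → Linked R xs → ∀ {i j : Fin (length xs)} → toℕ j ≡ suc (toℕ i) →
                  R (lookup xs i) (lookup xs j)
  Linked-lookup (r ∷ _)  {fzero}  {fsuc fzero} _  = r
  Linked-lookup (_ ∷ rs) {fsuc i} {fsuc j}     eq = Linked-lookup rs (suc-injective eq)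

  Linked-split : ∀ xs {y ys} → Linked R (xs ++ y ∷ ys) → Linked R (xs ∷ʳ y) × Linked R (y ∷ ys)
  Linked-split []           rs       = [-] , rs
  Linked-split (_ ∷ [])     (r ∷ rs) = r ∷ [-] , rs
  Linked-split (_ ∷ x ∷ xs) (r ∷ rs) = let l₁ , l₂ = Linked-split (x ∷ xs) rs in r ∷ l₁ , l₂

  Linked-glue : ∀ xs {y ys} → Linked R (xs ∷ʳ y) → Linked R (y ∷ ys) → Linked R (xs ++ y ∷ ys)
  Linked-glue []           _        rs = rs
  Linked-glue (_ ∷ [])     (r ∷ _)  rs = r ∷ rs
  Linked-glue (_ ∷ x ∷ xs) (r ∷ l₁) l₂ = r ∷ Linked-glue (x ∷ xs) l₁ l₂

  Linked-reverse-glue : Symmetric R → ∀ {x z} xs {ys} →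
                        Linked R (x ∷ xs ∷ʳ z) → Linked R (x ∷ ys) → Linked R (z ∷ xs ʳ++ x ∷ ys)
  Linked-reverse-glue sym []       (r ∷ _)  l = sym r ∷ l
  Linked-reverse-glue sym (_ ∷ xs) (r ∷ rs) l = Linked-reverse-glue sym xs rs (sym r ∷ l)

Unique-⊆⇒length≤ : ∀ {xs ys : List A} → Unique xs → xs ⊆ ys → length xs ≤ length ys
Unique-⊆⇒length≤ {xs = []}     _           _   = z≤n
Unique-⊆⇒length≤ {xs = x ∷ xs} (x∉ ∷ uniq) sub with ys₁ , ys₂ , refl ← ∈-∃++ (sub (here refl)) =
  subst (suc (length xs) ≤_) (sym (length-middle ys₁))
    (s≤s (Unique-⊆⇒length≤ uniq λ v∈xs → remove (sub (there v∈xs)) λ v≡x → All.lookup x∉ v∈xs (sym v≡x)))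
  where
    length-middle : ∀ ys {zs} → length (ys ++ x ∷ zs) ≡ suc (length (ys ++ zs))
    length-middle []       = refl
    length-middle (_ ∷ ys) = cong suc (length-middle ys)
    remove : ∀ {v} → v ∈ ys₁ ++ x ∷ ys₂ → v ≢ x → v ∈ ys₁ ++ ys₂
    remove v∈ v≢x with ∈-++⁻ ys₁ v∈
    ... | inj₁ v∈ys₁         = ∈-++⁺ˡ v∈ys₁
    ... | inj₂ (here v≡x)    = ⊥-elim (v≢x v≡x)
    ... | inj₂ (there v∈ys₂) = ∈-++⁺ʳ ys₁ v∈ys₂

Unique-resp-↭ : ∀ {xs ys : List A} → xs ↭ ys → Unique xs → Unique ys
Unique-resp-↭ p = Permutationₛ.Unique-resp-↭ (setoid _) (↭⇒↭ₛ p)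

insert-↭ : ∀ (ys : List A) {a x zs} → ys ++ a ∷ x ∷ zs ↭ x ∷ ys ++ a ∷ zs
insert-↭ ys = ↭-trans (++⁺ˡ ys (swap _ _ ↭-refl)) (shift _ ys _)

reverse-segment-↭ : ∀ (ys : List A) {a x b ws a' y zs} →
                    ys ++ a ∷ x ∷ b ∷ (ws ʳ++ a' ∷ y ∷ zs) ↭ x ∷ y ∷ ys ++ a ∷ a' ∷ ws ++ b ∷ zs
reverse-segment-↭ ys {a} {x} {b} {ws} {a'} {y} {zs} = begin
  ys ++ a ∷ x ∷ b ∷ (ws ʳ++ a' ∷ y ∷ zs)  ↭⟨ insert-↭ ys ⟩
  x ∷ ys ++ a ∷ b ∷ (ws ʳ++ a' ∷ y ∷ zs)  ↭⟨ prep x (++⁺ˡ ys (prep a (prep b (↭-sym (++↭ʳ++ ws _))))) ⟩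
  x ∷ ys ++ a ∷ b ∷ ws ++ a' ∷ y ∷ zs     ↭⟨ prep x (++⁺ˡ ys (prep a swap-ends)) ⟩
  x ∷ ys ++ a ∷ y ∷ a' ∷ ws ++ b ∷ zs     ↭⟨ prep x (insert-↭ ys) ⟩
  x ∷ y ∷ ys ++ a ∷ a' ∷ ws ++ b ∷ zs     ∎
  where
    open PermutationReasoning
    swap-ends : b ∷ ws ++ a' ∷ y ∷ zs ↭ y ∷ a' ∷ ws ++ b ∷ zs
    swap-ends = ↭-trans (shifts (b ∷ ws) (a' ∷ y ∷ [])) (swap a' y (↭-sym (shift b ws zs)))

pairs : List A → List (A × A)
pairs (x ∷ y ∷ xs) = (x , y) ∷ pairs (y ∷ xs)
pairs _            = []

length-pairs : ∀ (xs : List A) → length (pairs xs) ≡ pred (length xs)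
length-pairs []           = refl
length-pairs (_ ∷ [])     = refl
length-pairs (_ ∷ y ∷ xs) = cong suc (length-pairs (y ∷ xs))

∈-pairs⁻ : ∀ (xs : List A) {x y} → (x , y) ∈ pairs xs → ∃₂ λ ys zs → xs ≡ ys ++ x ∷ y ∷ zs
∈-pairs⁻ (_ ∷ _ ∷ xs) (here refl) = [] , xs , refl
∈-pairs⁻ (x ∷ y ∷ xs) (there p) with ys , zs , eq ← ∈-pairs⁻ (y ∷ xs) p = x ∷ ys , zs , cong (x ∷_) eq

Unique-map-pairs : ∀ (f : A × A → B) xs →
                   (∀ ys {x y} zs → xs ≡ ys ++ x ∷ y ∷ zs → f (x , y) ∉ map f (pairs (y ∷ zs))) →
                   Unique (map f (pairs xs))
Unique-map-pairs f []           _     = []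
Unique-map-pairs f (_ ∷ [])     _     = []
Unique-map-pairs f (x ∷ y ∷ xs) fresh =
  ¬Any⇒All¬ _ (fresh [] xs refl) ∷
  Unique-map-pairs f (y ∷ xs) λ ys zs eq → fresh (x ∷ ys) zs (cong (x ∷_) eq)

length-cartesianProduct : ∀ (xs : List A) (ys : List B) →
                          length (cartesianProduct xs ys) ≡ length xs * length ys
length-cartesianProduct []       ys = refl
length-cartesianProduct (x ∷ xs) ys =
  trans (length-++ (map (x ,_) ys)) (cong₂ _+_ (length-map (x ,_) ys) (length-cartesianProduct xs ys))

-- Counting vertices

module _ {n : ℕ} where
  open DecMembership (_≟ᶠ_ {n}) using (_∉?_)

  outside : List (Fin n) → List (Fin n)
  outside P = filter (_∉? P) (allFin n)

  length+outside≤ : ∀ {P} → Unique P → length P + length (outside P) ≤ n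
  length+outside≤ {P} uniq =
    subst₂ _≤_ (length-++ P) (length-tabulate (λ i → i))
      (Unique-⊆⇒length≤ (Uniqueₚ.++⁺ uniq (Uniqueₚ.filter⁺ (_∉? P) (Uniqueₚ.allFin⁺ n)) disjoint)
        λ _ → ∈-allFin _)
    where
      disjoint : Disjoint P (outside P)
      disjoint (v∈P , v∈out) = proj₂ (∈-filter⁻ (_∉? P) {xs = allFin n} v∈out) v∈P

  pairs≤outside² : ∀ {P} (g : Fin n → Fin n) → (∀ {v} → v ∈ P → g v ∉ P) →
                   Unique (map (Product.map g g) (pairs P)) →
                   pred (length P) ≤ length (outside P) * length (outside P)
  pairs≤outside² {P} g g∉ uniq =
    subst₂ _≤_ (trans (length-map _ (pairs P)) (length-pairs P)) (length-cartesianProduct (outside P) (outside P))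
      (Unique-⊆⇒length≤ uniq images⊆)
    where
      g∈outside : ∀ {v} → v ∈ P → g v ∈ outside P
      g∈outside v∈P = ∈-filter⁺ (_∉? P) (∈-allFin _) (g∉ v∈P)
      images⊆ : map (Product.map g g) (pairs P) ⊆ cartesianProduct (outside P) (outside P)
      images⊆ img∈ with (x , y) , xy∈ , refl ← ∈-map⁻ _ img∈ with ys , _ , refl ← ∈-pairs⁻ P xy∈ =
        ∈-cartesianProduct⁺ (g∈outside (∈-++⁺ʳ ys (here refl))) (g∈outside (∈-++⁺ʳ ys (there (here refl))))

m+d∸1≤pred[m]+d : ∀ m d → m + d ∸ 1 ≤ pred m + d
m+d∸1≤pred[m]+d zero    d = pred[n]≤n
m+d∸1≤pred[m]+d (suc m) d = ≤-refl

n∸1<[n+1∸m]^2 : ∀ m k {n} → m + k ≤ n → pred m ≤ k * k → n ∸ 1 < (n + 1 ∸ m) ^ 2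
n∸1<[n+1∸m]^2 m k m+k≤n pm≤kk with d , refl ← m≤n⇒∃[o]m+o≡n (≤-trans (m≤m+n m k) m+k≤n) = begin-strict
  m + d ∸ 1             ≤⟨ m+d∸1≤pred[m]+d m d ⟩
  pred m + d            ≤⟨ +-monoˡ-≤ d (≤-trans pm≤kk (*-mono-≤ k≤d k≤d)) ⟩
  d * d + d             ≡⟨ trans (+-comm (d * d) d) (sym (*-suc d d)) ⟩
  d * suc d             <⟨ m<n+m (d * suc d) z<s ⟩
  suc d * suc d         ≡⟨ cong (suc d *_) (sym (*-identityʳ (suc d))) ⟩
  suc d ^ 2             ≡⟨ cong (_^ 2) m+d+1∸m≡1+d ⟨
  (m + d + 1 ∸ m) ^ 2   ∎
  where
    open ≤-Reasoning
    k≤d = +-cancelˡ-≤ m k d m+k≤n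
    m+d+1∸m≡1+d = trans (cong (_∸ m) (+-assoc m d 1)) (trans (m+n∸m≡n m (d + 1)) (+-comm d 1))

-- Arithmetic modulo m and the cyclic successor

module _ {m : ℕ} .{{_ : NonZero m}} where
  open ≡-Reasoning

  [a%m+b]%m≡[a+b]%m : ∀ a b → (a % m + b) % m ≡ (a + b) % m
  [a%m+b]%m≡[a+b]%m a b = begin
    (a % m + b) % m          ≡⟨ %-distribˡ-+ (a % m) b m ⟩
    (a % m % m + b % m) % m  ≡⟨ cong (λ x → (x + b % m) % m) (m%n%n≡m%n a m) ⟩
    (a % m + b % m) % m      ≡⟨ %-distribˡ-+ a b m ⟨
    (a + b) % m              ∎

  [[p+s]%m+t]%m≡p : ∀ {s t p} → s + t ≡ m → p < m → ((p + s) % m + t) % m ≡ p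
  [[p+s]%m+t]%m≡p {s} {t} {p} s+t≡m p<m = begin
    ((p + s) % m + t) % m  ≡⟨ [a%m+b]%m≡[a+b]%m (p + s) t ⟩
    (p + s + t) % m        ≡⟨ cong (_% m) (trans (+-assoc p s t) (cong (p +_) s+t≡m)) ⟩
    (p + m) % m            ≡⟨ [m+n]%n≡m%n p m ⟩
    p % m                  ≡⟨ m<n⇒m%n≡m p<m ⟩
    p                      ∎

toℕ-next : ∀ {m} (i : Fin (suc m)) → toℕ (next i) ≡ (toℕ i + 1) % suc m
toℕ-next {m} i = trans (toℕ-fromℕ< _) (cong (_% suc m) (+-comm 1 (toℕ i)))

next-steps : ∀ {m} (i : Fin m) → suc (toℕ i) < m → toℕ (next i) ≡ suc (toℕ i)
next-steps {suc m} i lt = trans (toℕ-fromℕ< _) (m<n⇒m%n≡m lt)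

next-wraps : ∀ {m} (i : Fin m) → suc (toℕ i) ≡ m → toℕ (next i) ≡ 0
next-wraps {suc m} i eq = trans (toℕ-fromℕ< _) (trans (cong (_% suc m) eq) (n%n≡0 (suc m)))

next-injective : ∀ {m} {i j : Fin m} → next i ≡ next j → i ≡ j
next-injective {suc m} {i} {j} eq = toℕ-injective (begin
  toℕ i                              ≡⟨ back i ⟨
  ((toℕ i + 1) % suc m + m) % suc m  ≡⟨ cong (λ k → (k + m) % suc m) (trans (sym (toℕ-next i)) next≡) ⟩
  ((toℕ j + 1) % suc m + m) % suc m  ≡⟨ back j ⟩
  toℕ j                              ∎)
  where
    open ≡-Reasoning
    next≡ = trans (cong toℕ eq) (toℕ-next j)
    back : ∀ k → ((toℕ k + 1) % suc m + m) % suc m ≡ toℕ k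
    back k = [[p+s]%m+t]%m≡p refl (toℕ<n k)

next-mod : ∀ {m} .{{_ : NonZero m}} p → next (p mod m) ≡ suc p mod m
next-mod {suc m} p = toℕ-injective (begin
  toℕ (next (p mod suc m))         ≡⟨ toℕ-next (p mod suc m) ⟩
  (toℕ (p mod suc m) + 1) % suc m  ≡⟨ cong (λ k → (k + 1) % suc m) (toℕ-fromℕ< (m%n<n p (suc m))) ⟩
  (p % suc m + 1) % suc m          ≡⟨ [a%m+b]%m≡[a+b]%m p 1 ⟩
  (p + 1) % suc m                  ≡⟨ cong (_% suc m) (+-comm p 1) ⟩
  suc p % suc m                    ≡⟨ toℕ-fromℕ< _ ⟨
  toℕ (suc p mod suc m)            ∎)
  where open ≡-Reasoning

toℕ-mod : ∀ {m} .{{_ : NonZero m}} (i : Fin m) → toℕ i mod m ≡ i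
toℕ-mod {m} i = toℕ-injective (trans (toℕ-fromℕ< _) (m<n⇒m%n≡m (toℕ<n i)))

at-most-two-neighbours : ∀ {m} {i : Fin m} (j : Fin 3 → Fin m) → Injective _≡_ _≡_ j →
                         ¬ (∀ t → j t ≡ next i ⊎ i ≡ next (j t))
at-most-two-neighbours j j-inj side with side fzero | side (fsuc fzero) | side (fsuc (fsuc fzero))
... | inj₁ a | inj₁ b | _      with () ← j-inj (trans a (sym b))
... | inj₂ a | inj₂ b | _      with () ← j-inj (next-injective (trans (sym a) b))
... | inj₁ a | inj₂ _ | inj₁ c with () ← j-inj (trans a (sym c))
... | inj₁ _ | inj₂ b | inj₂ c with () ← j-inj (next-injective (trans (sym b) c))
... | inj₂ a | inj₁ _ | inj₂ c with () ← j-inj (next-injective (trans (sym a) c))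
... | inj₂ _ | inj₁ b | inj₁ c with () ← j-inj (trans b (sym c))

∀⊎⇒⊎∀ : ∀ {m} {B : Fin m → Set b} → (∀ i → A ⊎ B i) → A ⊎ (∀ i → B i)
∀⊎⇒⊎∀ {m = zero}  f = inj₂ λ ()
∀⊎⇒⊎∀ {m = suc m} f with f fzero | ∀⊎⇒⊎∀ (f ∘ fsuc)
... | inj₁ a | _       = inj₁ a
... | inj₂ _ | inj₁ a  = inj₁ a
... | inj₂ b | inj₂ bs = inj₂ λ { fzero → b ; (fsuc i) → bs i }

-- Paths

module _ {n} (G : SimpleGraph n) where
  open SimpleGraph G using (Adj) renaming (sym to Adj-sym)

  record IsPath (u w : Fin n) (P : List (Fin n)) : Set where
    field
      unique : Unique P
      linked : Linked Adj P
      starts : head P ≡ just u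
      ends   : last P ≡ just w

  open IsPath

  insert-IsPath : ∀ {u w} ys {a x b zs} → IsPath u w (ys ++ a ∷ b ∷ zs) →
                  Adj a x → Adj x b → x ∉ ys ++ a ∷ b ∷ zs → IsPath u w (ys ++ a ∷ x ∷ b ∷ zs)
  insert-IsPath ys path a~x x~b x∉ = record
    { unique = Unique-resp-↭ (↭-sym (insert-↭ ys)) (¬Any⇒All¬ _ x∉ ∷ unique path)
    ; linked = let l₁ , l₂ = Linked-split ys (linked path)
               in Linked-glue ys l₁ (a~x ∷ x~b ∷ Linked.tail l₂)
    ; starts = trans (head-++-∷ ys) (starts path)
    ; ends   = trans (last-++-∷ ys) (trans (sym (last-++-∷ ys)) (ends path))
    }

  reverse-IsPath : ∀ {u w} ys {a a' ws b b' zs x y} → IsPath u w (ys ++ a ∷ a' ∷ ws ++ b ∷ b' ∷ zs) →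
                   Adj a x → Adj x b → Adj a' y → Adj y b' → x ≢ y →
                   x ∉ ys ++ a ∷ a' ∷ ws ++ b ∷ b' ∷ zs → y ∉ ys ++ a ∷ a' ∷ ws ++ b ∷ b' ∷ zs →
                   IsPath u w (ys ++ a ∷ x ∷ b ∷ (ws ʳ++ a' ∷ y ∷ b' ∷ zs))
  reverse-IsPath ys {a' = a'} {ws} path a~x x~b a'~y y~b' x≢y x∉ y∉ = record
    { unique = Unique-resp-↭ (↭-sym (reverse-segment-↭ ys))
                 ((x≢y ∷ ¬Any⇒All¬ _ x∉) ∷ ¬Any⇒All¬ _ y∉ ∷ unique path)
    ; linked = let l₁ , l₂ = Linked-split ys (linked path)
                   l₃ , l₄ = Linked-split (a' ∷ ws) (Linked.tail l₂)
               in Linked-glue ys l₁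
                    (a~x ∷ x~b ∷ Linked-reverse-glue Adj-sym ws l₃ (a'~y ∷ y~b' ∷ Linked.tail l₄))
    ; starts = trans (head-++-∷ ys) (starts path)
    ; ends   = trans (trans (last-++-∷ ys) (last-∷-ʳ++ ws))
                 (trans (sym (trans (last-++-∷ ys) (last-++-∷ (a' ∷ ws)))) (ends path))
    }

  Longest : Fin n → Fin n → List (Fin n) → Set
  Longest u w P = ∀ {Q} → IsPath u w Q → P ⊆ Q → length Q ≤ length P

  Longest-no-detour : ∀ {u w P Q x xs} → Longest u w P → IsPath u w Q → Q ↭ x ∷ xs ++ P → ⊥
  Longest-no-detour {P = P} {Q} {xs = xs} longest path Q↭ = <⇒≱ longer (longest path P⊆Q)
    where
      P⊆Q : P ⊆ Q
      P⊆Q v∈P = ∈-resp-↭ (↭-sym Q↭) (there (∈-++⁺ʳ xs v∈P))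
      longer : length P < length Q
      longer = subst (length P <_) (sym (trans (↭-length Q↭) (cong suc (length-++ xs))))
                 (s≤s (m≤n+m (length P) (length xs)))

  record OffNeighbours (P : List (Fin n)) (g : Fin n → Fin n) : Set where
    field
      adjacent : ∀ {v} → v ∈ P → Adj v (g v)
      avoids   : ∀ {v} → v ∈ P → g v ∉ P

  module _ {u w P g} (path : IsPath u w P) (longest : Longest u w P) (off : OffNeighbours P g) where
    open OffNeighbours off

    consecutive-distinct : ∀ ys {a b} zs → P ≡ ys ++ a ∷ b ∷ zs → g a ≢ g b
    consecutive-distinct ys zs refl ga≡gb =
      Longest-no-detour {xs = []} longest (insert-IsPath ys path (adjacent a∈) x~b (avoids a∈)) (insert-↭ ys)
      where
        a∈  = ∈-++⁺ʳ ys (here refl)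
        x~b = subst (λ x → Adj x _) (sym ga≡gb) (Adj-sym (adjacent (∈-++⁺ʳ ys (there (here refl)))))

    crossing-impossible : ∀ ys {a a' b b'} ws zs → P ≡ ys ++ a ∷ a' ∷ ws ++ b ∷ b' ∷ zs →
                          g a ≡ g b → g a' ≡ g b' → ⊥
    crossing-impossible ys {a' = a'} ws zs refl ga≡gb ga'≡gb' =
      Longest-no-detour {xs = g a' ∷ []} longest
        (reverse-IsPath ys path (adjacent a∈) x~b (adjacent a'∈) y~b'
           (consecutive-distinct ys _ refl) (avoids a∈) (avoids a'∈))
        (reverse-segment-↭ ys {ws = ws})
      where
        a∈   = ∈-++⁺ʳ ys (here refl)
        a'∈  = ∈-++⁺ʳ ys (there (here refl))
        b∈   = ∈-++⁺ʳ ys (there (there (∈-++⁺ʳ ws (here refl))))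
        b'∈  = ∈-++⁺ʳ ys (there (there (∈-++⁺ʳ ws (there (here refl)))))
        x~b  = subst (λ x → Adj x _) (sym ga≡gb) (Adj-sym (adjacent b∈))
        y~b' = subst (λ y → Adj y _) (sym ga'≡gb') (Adj-sym (adjacent b'∈))

    Unique-offNeighbour-pairs : Unique (map (Product.map g g) (pairs P))
    Unique-offNeighbour-pairs = Unique-map-pairs _ P fresh
      where
        fresh : ∀ ys {x y} zs → P ≡ ys ++ x ∷ y ∷ zs →
                (g x , g y) ∉ map (Product.map g g) (pairs (y ∷ zs))
        fresh ys zs P≡ img∈ with (b , b') , bb'∈ , img≡ ← ∈-map⁻ _ img∈ with ∈-pairs⁻ _ bb'∈
        ... | []     , _   , refl = consecutive-distinct ys _ P≡ (cong proj₁ img≡)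
        ... | _ ∷ ws , zs' , refl = crossing-impossible ys ws zs' P≡ (cong proj₁ img≡) (cong proj₂ img≡)

  module _ {u w Q} (path : IsPath u w Q) where

    IsPath-first : ∀ j → toℕ j ≡ 0 → lookup Q j ≡ u
    IsPath-first j j≡0 = just-injective (trans (sym (head-lookup {xs = Q} j j≡0)) (starts path))

    IsPath-last : ∀ i → suc (toℕ i) ≡ length Q → lookup Q i ≡ w
    IsPath-last i last-i = just-injective (trans (sym (last-lookup {xs = Q} i last-i)) (ends path))

    module _ (3≤len : 3 ≤ length Q) (w~u : Adj w u) where

      closePath : Cycle G
      closePath = record
        { len    = length Q
        ; len≥3  = 3≤len
        ; vert   = lookup Q
        ; inj    = lookup-injective (unique path)
        ; adj    = consecutive
        }
        where
          consecutive : ∀ i → Adj (lookup Q i) (lookup Q (next i))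
          consecutive i with m≤n⇒m<n∨m≡n (toℕ<n i)
          ... | inj₁ steps = Linked-lookup (linked path) (next-steps i steps)
          ... | inj₂ wraps =
            subst₂ Adj (sym (IsPath-last i wraps)) (sym (IsPath-first (next i) (next-wraps i wraps))) w~u

      closePath-edge : EdgeOfCycle closePath w u
      closePath-edge = i , inj₁ (IsPath-last i last-i , IsPath-first (next i) (next-wraps i last-i))
        where
          instance _ = >-nonZero (≤-trans (s≤s z≤n) 3≤len)
          pred<len = m≤pred[n]⇒suc[m]≤n {n = length Q} ≤-refl
          i = fromℕ< pred<len
          last-i = trans (cong suc (toℕ-fromℕ< pred<len)) (suc-pred (length Q))

      closePath-on : ∀ {v} → v ∈ Q → OnCycle closePath v
      closePath-on v∈Q = Any.index v∈Q , sym (lookup-index v∈Q)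

-- Cycles

module _ {n} {G : SimpleGraph n} (C : Cycle G) where
  open SimpleGraph G using (Adj)

  instance
    len-nonZero : NonZero (len C)
    len-nonZero = >-nonZero (≤-trans (s≤s z≤n) (len≥3 C))

  OnCycle? : ∀ v → Dec (OnCycle C v)
  OnCycle? v = any? (λ i → vert C i ≟ᶠ v)

  three-on-cycle⇒chord : ∀ {i} (j : Fin 3 → Fin (len C)) → Injective _≡_ _≡_ j →
                         (∀ t → Adj (vert C i) (vert C (j t))) → HasChord C
  three-on-cycle⇒chord {i} j j-inj j-adj with any? (λ t → ¬? (j t ≟ᶠ next i) ×-dec ¬? (i ≟ᶠ next (j t)))
  ... | yes (t , j≢ , i≢) = i , j t , j-adj t , j≢ , i≢
  ... | no none = ⊥-elim (at-most-two-neighbours j j-inj λ t →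
                    decidable-stable ((j t ≟ᶠ next i) ⊎-dec (i ≟ᶠ next (j t)))
                      λ ¬side → none (t , ¬side ∘ inj₁ , ¬side ∘ inj₂))

  chord-or-offNeighbour : MinDegreeAtLeast3 G → ∀ i →
                          HasChord C ⊎ ∃ λ x → Adj (vert C i) x × ¬ OnCycle C x
  chord-or-offNeighbour δ i with f , f-inj , f-adj ← δ (vert C i) with all? (OnCycle? ∘ f)
  ... | no ¬all = let t , off = ¬∀⟶∃¬ 3 _ (OnCycle? ∘ f) ¬all in inj₂ (f t , f-adj t , off)
  ... | yes on  = inj₁ (three-on-cycle⇒chord (proj₁ ∘ on) j-inj j-adj)
    where
      j-inj : Injective _≡_ _≡_ (proj₁ ∘ on)
      j-inj {t} {t'} eq = f-inj (trans (sym (proj₂ (on t))) (trans (cong (vert C) eq) (proj₂ (on t'))))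
      j-adj : ∀ t → Adj (vert C i) (vert C (proj₁ (on t)))
      j-adj t = subst (Adj _) (sym (proj₂ (on t))) (f-adj t)

  module _ (e : Fin (len C)) where

    after : ℕ → Fin (len C)
    after p = (p + suc (toℕ e)) mod len C

    around : List (Fin n)
    around = applyUpTo (vert C ∘ after) (len C)

    private
      back : ∀ {p} → p < len C → ((p + suc (toℕ e)) % len C + (len C ∸ suc (toℕ e))) % len C ≡ p
      back = [[p+s]%m+t]%m≡p (m+[n∸m]≡n (toℕ<n e))

    after-injective : ∀ {p q} → p < len C → q < len C → after p ≡ after q → p ≡ q
    after-injective {p} {q} p< q< eq =
      trans (sym (back p<)) (trans (cong (λ k → (k + (len C ∸ suc (toℕ e))) % len C) %≡) (back q<))
      where
        %≡ = trans (sym (toℕ-fromℕ< _)) (trans (cong toℕ eq) (toℕ-fromℕ< _))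

    after-surjective : ∀ i → ∃ λ p → p < len C × after p ≡ i
    after-surjective i = (toℕ i + (len C ∸ suc (toℕ e))) % len C , m%n<n _ (len C) ,
      toℕ-injective (trans (toℕ-fromℕ< _) ([[p+s]%m+t]%m≡p (m∸n+n≡m (toℕ<n e)) (toℕ<n i)))

    after-first : after 0 ≡ next e
    after-first = trans (sym (next-mod (toℕ e))) (cong next (toℕ-mod e))

    after-last : after (pred (len C)) ≡ e
    after-last = toℕ-injective (begin
      toℕ (after (pred (len C)))            ≡⟨ toℕ-fromℕ< _ ⟩
      (pred (len C) + suc (toℕ e)) % len C  ≡⟨ cong (_% len C) pred+suc≡ ⟩
      (toℕ e + len C) % len C               ≡⟨ [m+n]%n≡m%n (toℕ e) (len C) ⟩
      toℕ e % len C                         ≡⟨ m<n⇒m%n≡m (toℕ<n e) ⟩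
      toℕ e                                 ∎)
      where
        open ≡-Reasoning
        pred+suc≡ = trans (+-suc _ (toℕ e))
                      (trans (cong (_+ toℕ e) (suc-pred (len C))) (+-comm (len C) (toℕ e)))

    around-IsPath : IsPath G (vert C (next e)) (vert C e) around
    around-IsPath = record
      { unique = Uniqueₚ.applyUpTo⁺₁ _ (len C) λ p<q q< eq →
                   <⇒≢ p<q (after-injective (<-trans p<q q<) q< (inj C eq))
      ; linked = Linkedₚ.applyUpTo⁺₂ _ (len C) λ p →
                   subst (λ i → Adj (vert C (after p)) (vert C i)) (next-mod _) (adj C (after p))
      ; starts = trans (head-applyUpTo _ (len C)) (cong (just ∘ vert C) after-first)
      ; ends   = trans (last-applyUpTo _ (len C)) (cong (just ∘ vert C) after-last)
      }

    length-around : length around ≡ len C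
    length-around = length-applyUpTo _ (len C)

    ∈-around : ∀ i → vert C i ∈ around
    ∈-around i with p , p< , refl ← after-surjective i = ∈-applyUpTo⁺ _ p<

    around-OnCycle : ∀ {v} → v ∈ around → OnCycle C v
    around-OnCycle v∈ with p , _ , refl ← ∈-applyUpTo⁻ _ v∈ = after p , refl

  module _ (off : ∀ i → ∃ λ x → Adj (vert C i) x × ¬ OnCycle C x) where

    -- A junk value (v itself) off the cycle, where offChoice is never used.
    offChoice : Fin n → Fin n
    offChoice v with OnCycle? v
    ... | yes (i , _) = proj₁ (off i)
    ... | no _        = v

    offChoice-spec : ∀ {v} → OnCycle C v → Adj v (offChoice v) × ¬ OnCycle C (offChoice v)
    offChoice-spec {v} on with OnCycle? v
    ... | yes (i , refl) = proj₂ (off i)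
    ... | no ¬on         = ⊥-elim (¬on on)

    around-OffNeighbours : ∀ e → OffNeighbours G (around e) offChoice
    around-OffNeighbours e = record
      { adjacent = λ v∈ → proj₁ (offChoice-spec (around-OnCycle e v∈))
      ; avoids   = λ v∈ g∈ → proj₂ (offChoice-spec (around-OnCycle e v∈)) (around-OnCycle e g∈)
      }

Anchor : ∀ {n} {G : SimpleGraph n} → LinearForest≤1 G → (C : Cycle G) → Fin (len C) → Set
Anchor {G = G} F C e = ∀ (D : Cycle G) → EdgeOfCycle D (vert C e) (vert C (next e)) →
                       (∀ v → LinearForest≤1.V F v → OnCycle D v) → Contains D F

anchor : ∀ {n} {G : SimpleGraph n} {F : LinearForest≤1 G} {C : Cycle G} → Contains C F → ∃ (Anchor F C)
anchor {F = record { edge = nothing }} {C} _ =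
  fromℕ< (≤-trans (s≤s z≤n) (len≥3 C)) , λ _ _ covers → covers , tt
anchor {F = record { edge = just _ }} (_ , e , inj₁ (eu , ev)) =
  e , λ D E covers → covers , subst₂ (EdgeOfCycle D) eu ev E
anchor {F = record { edge = just _ }} (_ , e , inj₂ (ev , eu)) =
  e , λ D E covers → covers , Product.map₂ Sum.swap (subst₂ (EdgeOfCycle D) ev eu E)

module _ {n} {G : SimpleGraph n} {F : LinearForest≤1 G} {C : Cycle G} where

  around-Longest : LongestContaining F C → ∀ {e} → Anchor F C e →
                   Longest G (vert C (next e)) (vert C e) (around C e)
  around-Longest (contains , longest) {e} anchored {Q} path around⊆Q =
    subst (length Q ≤_) (sym (length-around C e))
      (longest D (anchored D (closePath-edge G path 3≤ (adj C e)) covers))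
    where
      3≤ : 3 ≤ length Q
      3≤ = ≤-trans (len≥3 C) (subst (_≤ length Q) (length-around C e)
             (Unique-⊆⇒length≤ (IsPath.unique (around-IsPath C e)) around⊆Q))
      D = closePath G path 3≤ (adj C e)
      covers : ∀ v → LinearForest≤1.V F v → OnCycle D v
      covers v Vv with i , refl ← proj₁ contains v Vv =
        closePath-on G path 3≤ (adj C e) (around⊆Q (∈-around C e i))

  longestChordless-bound : LongestContaining F C →
                           (∀ i → ∃ λ x → SimpleGraph.Adj G (vert C i) x × ¬ OnCycle C x) →
                           ∃ λ k → len C + k ≤ n × pred (len C) ≤ k * k
  longestChordless-bound longest off with e , anchored ← anchor (proj₁ longest) =
    k ,
    subst (λ l → l + k ≤ n) (length-around C e) (length+outside≤ (IsPath.unique path)) ,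
    subst (λ l → pred l ≤ k * k) (length-around C e)
      (pairs≤outside² (offChoice C off) (OffNeighbours.avoids choice)
        (Unique-offNeighbour-pairs G path (around-Longest longest anchored) choice))
    where
      k = length (outside (around C e))
      path = around-IsPath C e
      choice = around-OffNeighbours C off e

theorem2p5 : (n : ℕ) (G : SimpleGraph n) → Connected G → MinDegreeAtLeast3 G →
    (F : LinearForest≤1 G) (C : Cycle G) → LongestContaining F C →
    -- len C ≥ n - √(n-1) + 1, i.e. (n + 1 - len C)² ≤ n - 1 (see NOTES)
    (n + 1 ∸ Cycle.len C) ^ 2 ≤ n ∸ 1 →
    HasChord C
theorem2p5 n G _ δ F C longest bound with ∀⊎⇒⊎∀ (chord-or-offNeighbour C δ)
... | inj₁ chord = chord
... | inj₂ off with k , size , pairCount ← longestChordless-bound longest off =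
  ⊥-elim (<⇒≱ (n∸1<[n+1∸m]^2 (len C) k size pairCount) bound)
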